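{- Let $q=p^h$ with $p$ prime, and let $L$ be an $\mathbb{F}_p$-linear set of rank $hm$ in $\mathrm{PG}(m,q)$. Then \[|L|\leq q^{m-1}\frac{q-1}{p-1}+\frac{q^{m-1}-1}{q-1}.\]
   Context: Let $V=\mathbb{F}_q^{m+1}$ be the vector space underlying $\mathrm{PG}(m,q)$, viewed also as an $\mathbb{F}_p$-vector space. An $\mathbb{F}_p$-linear set of rank $r$ is a set of the form $L_U=\{\langle u\rangle_{\mathbb{F}_q}: u\in U\setminus\{0\}\}$ where $U$ is an $r$-dimensional $\mathbb{F}_p$-subspace of $V$. -}

module Defs where

open import Level using (_⊔_)
open import Algebra.Bundles using (CommutativeRing)
open import Data.Nat using (ℕ; zero; suc)
open import Data.Fin using (Fin; toℕ)
open import Data.Product using (Σ; ∃; _×_)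
open import Relation.Nullary using (¬_)
open import Relation.Binary.PropositionalEquality using (_≡_)

module FF {c ℓ} (R : CommutativeRing c ℓ) where
  open CommutativeRing R renaming (Carrier to K)

  IsFieldCR : Set (c ⊔ ℓ)
  IsFieldCR = (¬ (1# ≈ 0#)) × (∀ x → ¬ (x ≈ 0#) → Σ K λ y → x * y ≈ 1#)

  HasOrder : ℕ → Set (c ⊔ ℓ)
  HasOrder q = Σ (Fin q → K) λ e →
    (∀ i j → e i ≈ e j → i ≡ j) × (∀ x → Σ (Fin q) λ i → e i ≈ x)

  Vect : ℕ → Set c
  Vect m = Fin (suc m) → K

  _≈V_ : ∀ {m} → Vect m → Vect m → Set ℓ
  u ≈V v = ∀ t → u t ≈ v t

  0V : ∀ {m} → Vect m
  0V t = 0#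

  _+V_ : ∀ {m} → Vect m → Vect m → Vect m
  (u +V v) t = u t + v t

  -- natural-number multiple n·x = x + ... + x (the F_p-scalar action)
  _·_ : ℕ → K → K
  zero · x = 0#
  suc n · x = x + (n · x)

  comb : ∀ {m p r} → (Fin r → Fin p) → (Fin r → Vect m) → Vect m
  comb {r = zero}  c b = 0V
  comb {r = suc r} c b t = (toℕ (c Fin.zero) · b Fin.zero t)
                           + comb (λ i → c (Fin.suc i)) (λ i → b (Fin.suc i)) t

  LinIndepFp : ∀ {m} (p : ℕ) {r} → (Fin r → Vect m) → Set ℓ
  LinIndepFp p b = ∀ (c : Fin _ → Fin p) → comb c b ≈V 0V → ∀ i → toℕ (c i) ≡ 0

  InSpanFp : ∀ {m} (p : ℕ) {r} → (Fin r → Vect m) → Vect m → Set ℓ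
  InSpanFp p {r} b v = Σ (Fin r → Fin p) λ c → v ≈V comb c b

  NonzeroV : ∀ {m} → Vect m → Set ℓ
  NonzeroV v = ¬ (v ≈V 0V)

  -- ⟨u⟩_{F_q} = ⟨v⟩_{F_q} (for nonzero u, v): v = λ u for some λ ∈ F_q
  SamePoint : ∀ {m} → Vect m → Vect m → Set (c ⊔ ℓ)
  SamePoint u v = Σ K λ a → ∀ t → v t ≈ a * u t

-- Let K = F_q and let S ⊂ K be an F_p-hyperplane. Covectors a ∈ K^(m+1) outnumber the p^(hm) possible
-- tuples of classes of a·b_j modulo S, so the difference a ≠ 0 of two covectors with the same
-- tuple satisfies a·U ⊆ S. As |S| = q/p, the hyperplane H = ker a meets U in at least p q^(m-1)
-- vectors. A point of L off H uses up p − 1 vectors of U ∖ H, and a point on H uses up q − 1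
-- vectors of H ∖ {0}, whence
--   |L| ≤ (q^m − p q^(m-1)) / (p − 1) + (q^m − 1) / (q − 1),
-- which is the asserted bound. Vectors of U are counted through their coefficient tuples in F_p^(hm).

module Submission where

open import Defs
open import Algebra.Bundles using (CommutativeRing)
open import Data.Fin using (Fin; zero; suc; toℕ; combine; remQuot; funToFin; finToFun;
  punchIn; punchOut)
open import Data.Fin.Permutation using (permutation)
open import Data.Fin.Properties using (toℕ<n; toℕ-injective; toℕ-fromℕ<; combine-injective;
  combine-remQuot; suc-injective; finToFun-funToFin; funToFin-finToFin; injective⇒≤; pigeonhole;
  punchIn-injective; punchInᵢ≢i; punchIn-punchOut; any?; all?; ¬∀⟶∃¬; <⇒≢)
  renaming (_≟_ to _≟ᶠ_)
import Data.Nat as ℕ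
open import Data.Nat using (ℕ; zero; suc; pred; NonZero; _^_; _≤_; _<_; s≤s; z≤n)
open import Data.Nat.Coprimality using (coprime-Bézout; prime⇒coprime)
open import Data.Nat.DivMod using (_%_; _/_; _mod_; m%n<n; m≡m%n+[m/n]*n; m<n⇒m%n≡m;
  %-distribˡ-+; [m+kn]%n≡m%n)
open import Data.Nat.GCD using (module Bézout)
open import Data.Nat.Primality using (Prime; prime⇒nonZero; prime⇒nonTrivial)
import Data.Nat.Properties as ℕₚ
open import Data.Nat.Tactic.RingSolver using (solve-∀)
open import Data.Product using (Σ; ∃; _×_; _,_; proj₁; proj₂; uncurry)
open import Data.Sum using (_⊎_; inj₁; inj₂)
open import Data.Vec.Functional using (_∷_)
open import Function using (_∘_; case_of_)
open import Relation.Binary using (tri<; tri≈; tri>)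
open import Relation.Binary.PropositionalEquality as ≡ using (_≡_; _≢_; _≗_)
open import Relation.Nullary using (¬_; Dec; yes; no; contradiction)
open import Relation.Nullary.Decidable using (map′)
open import Relation.Unary using (Decidable)

-- Tuples, subsets and counting on finite index sets.

funToFin-cong : ∀ {m n} {f g : Fin m → Fin n} → f ≗ g → funToFin f ≡ funToFin g
funToFin-cong {zero}  f≗g = ≡.refl
funToFin-cong {suc m} f≗g = ≡.cong₂ combine (f≗g zero) (funToFin-cong (f≗g ∘ suc))

funToFin-injective : ∀ {m n} (f g : Fin m → Fin n) → funToFin f ≡ funToFin g → f ≗ g
funToFin-injective f g eq i = ≡.trans (≡.sym (finToFun-funToFin f i))
  (≡.trans (≡.cong (λ c → finToFun c i) eq) (finToFun-funToFin g i))

finToFun-injective : ∀ {m n} (i j : Fin (m ^ n)) → finToFun {m} {n} i ≗ finToFun j → i ≡ j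
finToFun-injective {m} {n} i j eq = ≡.trans (≡.sym (funToFin-finToFin {n} {m} i))
  (≡.trans (funToFin-cong eq) (funToFin-finToFin {n} {m} j))

-- A counted subset of `Fin n`. Since `elem` is injective and `elem-index` returns `x`, `index`
-- cannot depend on the proof of membership that it receives, so `index-injective` compares elements
-- only.
record Enumeration {ℓ n} (P : Fin n → Set ℓ) : Set ℓ where
  field
    size           : ℕ
    elem           : Fin size → Fin n
    elem-injective : ∀ i j → elem i ≡ elem j → i ≡ j
    holds          : ∀ i → P (elem i)
    index          : ∀ {x} → P x → Fin size
    elem-index     : ∀ {x} (px : P x) → elem (index px) ≡ x

  index-injective : ∀ {x y} (px : P x) (py : P y) → index px ≡ index py → x ≡ y
  index-injective px py eq =
    ≡.trans (≡.sym (elem-index px)) (≡.trans (≡.cong elem eq) (elem-index py))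

open Enumeration

module _ {ℓ n} {P : Fin (suc n) → Set ℓ} (E : Enumeration (P ∘ suc)) where

  include-zero : P zero → Enumeration P
  include-zero p₀ = record
    { size           = suc (size E)
    ; elem           = elem′
    ; elem-injective = injective
    ; holds          = λ { zero → p₀ ; (suc i) → holds E i }
    ; index          = index′ _
    ; elem-index     = elem-index′ _
    }
    where
    elem′ : Fin (suc (size E)) → Fin (suc n)
    elem′ zero    = zero
    elem′ (suc i) = suc (elem E i)
    injective : ∀ i j → elem′ i ≡ elem′ j → i ≡ j
    injective zero    zero    _  = ≡.refl
    injective (suc i) (suc j) eq = ≡.cong suc (elem-injective E i j (suc-injective eq))
    index′ : ∀ x → P x → Fin (suc (size E))
    index′ zero    _  = zero
    index′ (suc x) px = suc (index E px)
    elem-index′ : ∀ x (px : P x) → elem′ (index′ x px) ≡ x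
    elem-index′ zero    _  = ≡.refl
    elem-index′ (suc x) px = ≡.cong suc (elem-index E px)

  exclude-zero : ¬ P zero → Enumeration P
  exclude-zero ¬p₀ = record
    { size           = size E
    ; elem           = suc ∘ elem E
    ; elem-injective = λ i j → elem-injective E i j ∘ suc-injective
    ; holds          = holds E
    ; index          = index′ _
    ; elem-index     = elem-index′ _
    }
    where
    index′ : ∀ x → P x → Fin (size E)
    index′ zero    p₀ = contradiction p₀ ¬p₀
    index′ (suc x) px = index E px
    elem-index′ : ∀ x (px : P x) → suc (elem E (index′ x px)) ≡ x
    elem-index′ zero    p₀ = contradiction p₀ ¬p₀
    elem-index′ (suc x) px = ≡.cong suc (elem-index E px)

partition : ∀ {ℓ n} {P : Fin n → Set ℓ} → Decidable P →
  Σ (Enumeration P) λ E → Σ (Enumeration (¬_ ∘ P)) λ F → size E ℕ.+ size F ≡ n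
partition {n = zero} P? = empty , empty , ≡.refl
  where
  empty : ∀ {ℓ} {P : Fin 0 → Set ℓ} → Enumeration P
  empty = record
    { size = 0 ; elem = λ () ; elem-injective = λ () ; holds = λ ()
    ; index = λ { {()} } ; elem-index = λ { {()} } }
partition {n = suc n} P? with P? zero | partition (P? ∘ suc)
... | yes p₀ | E , F , eq = include-zero E p₀ , exclude-zero F (λ ¬p₀ → ¬p₀ p₀) , ≡.cong suc eq
... | no ¬p₀ | E , F , eq =
  exclude-zero E ¬p₀ , include-zero F ¬p₀ , ≡.trans (ℕₚ.+-suc _ _) (≡.cong suc eq)

-- Written with `pred n` so that it applies to a power such as `q`, which is not syntactically a
-- successor.
complement : ∀ {n} (z : Fin n) → ∃ λ (f : Fin (pred n) → Fin n) →
  (∀ i → f i ≢ z) × (∀ i j → f i ≡ f j → i ≡ j)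
complement {suc n} z = punchIn z , punchInᵢ≢i z , punchIn-injective z

Injective₂ : ∀ {a b n} → (Fin a → Fin b → Fin n) → Set
Injective₂ f = ∀ i j k l → f i j ≡ f k l → i ≡ k × j ≡ l

module _ {a b n} (f : Fin a → Fin b → Fin n) (f-injective : Injective₂ f) where

  private
    f′ : Fin (a ℕ.* b) → Fin n
    f′ = uncurry f ∘ remQuot b

    f′-injective : ∀ {x y} → f′ x ≡ f′ y → x ≡ y
    f′-injective {x} {y} eq with i≡k , j≡l ← f-injective _ _ _ _ eq =
      ≡.trans (≡.sym (combine-remQuot {a} b x))
        (≡.trans (≡.cong₂ combine i≡k j≡l) (combine-remQuot {a} b y))

  injective₂⇒≤ : a ℕ.* b ≤ n
  injective₂⇒≤ = injective⇒≤ f′-injective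

  -- Putting the missed value `z` in front of the values of `f` keeps them distinct and gives one
  -- more of them.
  injective₂⇒< : (z : Fin n) → (∀ i j → f i j ≢ z) → a ℕ.* b < n
  injective₂⇒< z avoids = injective⇒≤ {f = z ∷ f′} injective
    where
    injective : ∀ {x y} → (z ∷ f′) x ≡ (z ∷ f′) y → x ≡ y
    injective {zero}  {zero}  _  = ≡.refl
    injective {zero}  {suc y} eq = contradiction (≡.sym eq) (avoids _ _)
    injective {suc x} {zero}  eq = contradiction eq (avoids _ _)
    injective {suc x} {suc y} eq = ≡.cong suc (f′-injective eq)

-- A proof of A made independent of the given one: the second clause is never reached.
choose : ∀ {ℓ} {A : Set ℓ} → Dec A → A → A
choose (yes a) _ = a
choose (no  _) a = a

choose-irrelevant : ∀ {ℓ} {A : Set ℓ} (d : Dec A) a b → choose d a ≡ choose d b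
choose-irrelevant (yes _) _ _ = ≡.refl
choose-irrelevant (no ¬a) a _ = contradiction a ¬a

-- Each `x` is labelled by its fibre and by `g`, which compares it with a representative of that
-- fibre. Labels are injective only if all members of a fibre get the same representative, hence the
-- passage through `choose`.
fibres-bound : ∀ {n k l} (f : Fin n → Fin k) (g : ∀ x y → f x ≡ f y → Fin l) →
  (∀ {x x′} y eq eq′ → g x y eq ≡ g x′ y eq′ → x ≡ x′) → n ≤ k ℕ.* l
fibres-bound {n} {k} {l} f g g-injective = injective⇒≤ {f = label} label-injective
  where
  rep : ∀ c → ∃ (λ x → f x ≡ c) → ∃ (λ x → f x ≡ c)
  rep c = choose (any? (λ x → f x ≟ᶠ c))
  rep-cong : ∀ {c d} a b → c ≡ d → proj₁ (rep c a) ≡ proj₁ (rep d b)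
  rep-cong {c} a b ≡.refl = ≡.cong proj₁ (choose-irrelevant (any? (λ x → f x ≟ᶠ c)) a b)
  repOf : ∀ x → ∃ λ y → f y ≡ f x
  repOf x = rep (f x) (x , ≡.refl)
  label : Fin n → Fin (k ℕ.* l)
  label x = combine (f x) (g x (proj₁ (repOf x)) (≡.sym (proj₂ (repOf x))))
  g-injective′ : ∀ {x x′ y y′ eq eq′} → y ≡ y′ → g x y eq ≡ g x′ y′ eq′ → x ≡ x′
  g-injective′ ≡.refl = g-injective _ _ _
  label-injective : ∀ {x x′} → label x ≡ label x′ → x ≡ x′
  label-injective {x} {x′} eq with fx≡fx′ , gx≡gx′ ← combine-injective (f x) _ (f x′) _ eq =
    g-injective′ (rep-cong _ _ fx≡fx′) gx≡gx′

+-cancelʳ-% : ∀ a b s p .{{_ : NonZero p}} → a < p → b < p →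
  (a ℕ.+ s) % p ≡ (b ℕ.+ s) % p → a ≡ b
+-cancelʳ-% a b s p a<p b<p eq =
  ≡.trans (≡.sym (recover a a<p)) (≡.trans (≡.cong (λ x → (x ℕ.+ s′ % p) % p) eq) (recover b b<p))
  where
  -- This is the negative of `s` modulo `p`; adding it undoes the addition of `s`.
  s′ = pred p ℕ.* s
  s+s′ : s ℕ.+ s′ ≡ s ℕ.* p
  s+s′ = ≡.trans (≡.cong (ℕ._* s) (ℕₚ.suc-pred p)) (ℕₚ.*-comm p s)
  recover : ∀ a → a < p → ((a ℕ.+ s) % p ℕ.+ s′ % p) % p ≡ a
  recover a a<p = begin
    ((a ℕ.+ s) % p ℕ.+ s′ % p) % p  ≡⟨ %-distribˡ-+ (a ℕ.+ s) s′ p ⟨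
    (a ℕ.+ s ℕ.+ s′) % p            ≡⟨ ≡.cong (_% p) (≡.trans (ℕₚ.+-assoc a s s′) (≡.cong (a ℕ.+_) s+s′)) ⟩
    (a ℕ.+ s ℕ.* p) % p             ≡⟨ [m+kn]%n≡m%n a s p ⟩
    a % p                           ≡⟨ m<n⇒m%n≡m a<p ⟩
    a                               ∎
    where open ≡.≡-Reasoning

-- Arithmetic of a field of order `p ^ h` and of its prime field.

module FieldOfOrder {ℓ₀ ℓ} (R : CommutativeRing ℓ₀ ℓ) (isField : FF.IsFieldCR R)
  (p h : ℕ) (p-prime : Prime p) (order : FF.HasOrder R (p ^ h)) where

  open FF R
  open CommutativeRing R hiding (zero) renaming (Carrier to K)
  open import Algebra.Properties.Ring ring
    using (+-cancelˡ; +-cancelʳ; +-inverseʳ-unique; +-identityʳ-unique; x≈z//y)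
  open import Algebra.Properties.AbelianGroup +-abelianGroup using (⁻¹-anti-homo‿-)
  open import Algebra.Properties.CommutativeSemigroup +-commutativeSemigroup
    using () renaming (interchange to +-interchange)
  open import Algebra.Properties.Semiring.Mult semiring
    using (×-congʳ; ×-homo-+; ×-assocˡ; ×-assoc-*; ×1-homo-*) renaming (_×_ to _∙_)
  open import Algebra.Properties.CommutativeMonoid.Mult +-commutativeMonoid using (×-distrib-+)
  open import Algebra.Properties.Semiring.Sum semiring
    using (sum; sum-cong-≋; sum-replicate; *-distribˡ-sum)
  open import Algebra.Properties.CommutativeMonoid.Sum +-commutativeMonoid
    using (sum-permute; ∑-distrib-+; sum-remove)
  open import Relation.Binary.Reasoning.Setoid setoid

  private
    q : ℕ
    q = p ^ h

    instance
      p≢0 : NonZero p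
      p≢0 = prime⇒nonZero p-prime
      q≢0 : NonZero q
      q≢0 = ℕₚ.m^n≢0 p h

    1<p : 1 < p
    1<p = ℕ.nonTrivial⇒n>1 p {{prime⇒nonTrivial p-prime}}

    enum : Fin q → K
    enum = proj₁ order

    code : K → Fin q
    code x = proj₁ (proj₂ (proj₂ order) x)

    enum-code : ∀ x → enum (code x) ≈ x
    enum-code x = proj₂ (proj₂ (proj₂ order) x)

  code-cong : ∀ {x y} → x ≈ y → code x ≡ code y
  code-cong x≈y = proj₁ (proj₂ order) _ _ (trans (enum-code _) (trans x≈y (sym (enum-code _))))

  code-injective : ∀ {x y} → code x ≡ code y → x ≈ y
  code-injective eq = trans (sym (enum-code _)) (trans (reflexive (≡.cong enum eq)) (enum-code _))

  code-enum : ∀ i → code (enum i) ≡ i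
  code-enum i = proj₁ (proj₂ order) _ _ (enum-code (enum i))

  _≈?_ : ∀ x y → Dec (x ≈ y)
  x ≈? y = map′ code-injective code-cong (code x ≟ᶠ code y)

  1≉0 : ¬ (1# ≈ 0#)
  1≉0 = proj₁ isField

  x*y≈0⇒y≈0 : ∀ {x y} → ¬ (x ≈ 0#) → x * y ≈ 0# → y ≈ 0#
  x*y≈0⇒y≈0 {x} {y} x≉0 xy≈0 with x⁻¹ , xx⁻¹≈1 ← proj₂ isField x x≉0 = begin
    y              ≈⟨ *-identityˡ y ⟨
    1# * y         ≈⟨ *-congʳ (trans (*-comm x⁻¹ x) xx⁻¹≈1) ⟨
    x⁻¹ * x * y    ≈⟨ *-assoc x⁻¹ x y ⟩
    x⁻¹ * (x * y)  ≈⟨ *-congˡ xy≈0 ⟩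
    x⁻¹ * 0#       ≈⟨ zeroʳ x⁻¹ ⟩
    0#             ∎

  x-y≈0⇒x≈y : ∀ {x y} → x - y ≈ 0# → x ≈ y
  x-y≈0⇒x≈y {x} {y} eq = +-cancelʳ (- y) x y (trans eq (sym (-‿inverseʳ y)))

  *-cancelˡ-nonzero : ∀ {a x y} → ¬ (a ≈ 0#) → a * x ≈ a * y → x ≈ y
  *-cancelˡ-nonzero {a} {x} {y} a≉0 eq = x-y≈0⇒x≈y (x*y≈0⇒y≈0 a≉0 (begin
    a * (x - y)        ≈⟨ distribˡ a x (- y) ⟩
    a * x + a * (- y)  ≈⟨ +-congʳ eq ⟩
    a * y + a * (- y)  ≈⟨ distribˡ a y (- y) ⟨
    a * (y - y)        ≈⟨ *-congˡ (-‿inverseʳ y) ⟩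
    a * 0#             ≈⟨ zeroʳ a ⟩
    0#                 ∎))

  ∙≈* : ∀ n x → n ∙ x ≈ (n ∙ 1#) * x
  ∙≈* n x = sym (trans (×-assoc-* n 1# x) (×-congʳ n (*-identityˡ x)))

  sum-cong : ∀ {n} (f g : Fin n → K) → (∀ t → f t ≈ g t) → sum f ≈ sum g
  sum-cong f g = sum-cong-≋ {_} {f} {g}

  -- Translation by a permutes the field, so the sum of all elements equals itself plus q ∙ a.
  q∙x≈0 : ∀ x → q ∙ x ≈ 0#
  q∙x≈0 a = +-identityʳ-unique (sum enum) (q ∙ a) (sym (begin
    sum enum                                 ≈⟨ sum-permute enum translation ⟩
    sum (enum ∘ shift a)                     ≈⟨ sum-cong (enum ∘ shift a) (λ i → enum i + a) (λ i → enum-code _) ⟩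
    sum (λ i → enum i + a)                   ≈⟨ ∑-distrib-+ enum (λ _ → a) ⟩
    sum enum + sum {q} (λ _ → a)             ≈⟨ +-congˡ (sum-replicate q) ⟩
    sum enum + q ∙ a                         ∎))
    where
    shift : K → Fin q → Fin q
    shift x i = code (enum i + x)
    cancels : ∀ {x y} → x + y ≈ 0# → ∀ i → shift y (shift x i) ≡ i
    cancels {x} {y} x+y≈0 i = ≡.trans (code-cong (begin
      enum (code (enum i + x)) + y  ≈⟨ +-congʳ (enum-code _) ⟩
      enum i + x + y                ≈⟨ +-assoc _ x y ⟩
      enum i + (x + y)              ≈⟨ +-congˡ x+y≈0 ⟩
      enum i + 0#                   ≈⟨ +-identityʳ _ ⟩
      enum i                        ∎)) (code-enum i)
    translation = permutation (shift a) (shift (- a)) (cancels (-‿inverseˡ a)) (cancels (-‿inverseʳ a))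

  -- If `p ∙ 1#` were nonzero, so would be its powers `(p ^ k) ∙ 1#`, as there are no zero divisors;
  -- but `q ∙ 1#` vanishes.
  p∙1≈0 : p ∙ 1# ≈ 0#
  p∙1≈0 with (p ∙ 1#) ≈? 0#
  ... | yes p∙1≈0 = p∙1≈0
  ... | no  p∙1≉0 = contradiction (q∙x≈0 1#) (power≉0 h)
    where
    power≉0 : ∀ k → ¬ ((p ^ k) ∙ 1# ≈ 0#)
    power≉0 zero    eq = 1≉0 (trans (sym (+-identityʳ 1#)) eq)
    power≉0 (suc k) eq = power≉0 k (x*y≈0⇒y≈0 p∙1≉0 (trans (sym (×1-homo-* p (p ^ k))) eq))

  p∙x≈0 : ∀ x → p ∙ x ≈ 0#
  p∙x≈0 x = trans (∙≈* p x) (trans (*-congʳ p∙1≈0) (zeroˡ x))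

  ∙-0# : ∀ n → n ∙ 0# ≈ 0#
  ∙-0# zero    = refl
  ∙-0# (suc n) = trans (+-identityˡ _) (∙-0# n)

  *p∙x≈0 : ∀ n x → (n ℕ.* p) ∙ x ≈ 0#
  *p∙x≈0 n x = trans (sym (×-assocˡ x n p)) (trans (×-congʳ n (p∙x≈0 x)) (∙-0# n))

  %-∙ : ∀ n x → (n % p) ∙ x ≈ n ∙ x
  %-∙ n x = begin
    (n % p) ∙ x                          ≈⟨ +-identityʳ _ ⟨
    (n % p) ∙ x + 0#                     ≈⟨ +-congˡ (*p∙x≈0 (n / p) x) ⟨
    (n % p) ∙ x + (n / p ℕ.* p) ∙ x      ≈⟨ ×-homo-+ x (n % p) (n / p ℕ.* p) ⟨
    (n % p ℕ.+ n / p ℕ.* p) ∙ x          ≡⟨ ≡.cong (_∙ x) (m≡m%n+[m/n]*n n p) ⟨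
    n ∙ x                                ∎

  -- Prime field scalars are natural numbers here, and `pred p` serves as the scalar minus one.
  pred-p∙x≈-x : ∀ x → pred p ∙ x ≈ - x
  pred-p∙x≈-x x = +-inverseʳ-unique x (pred p ∙ x)
    (trans (reflexive (≡.cong (_∙ x) (ℕₚ.suc-pred p))) (p∙x≈0 x))

  ∙-inverse : ∀ n → suc n < p → ∃ λ k → ∀ x → k ∙ (suc n ∙ x) ≈ x
  ∙-inverse n n<p with coprime-Bézout (prime⇒coprime p-prime n<p)
  ... | Bézout.-+ a k eq = k , λ x → begin
    k ∙ (suc n ∙ x)                ≈⟨ ×-assocˡ x k (suc n) ⟩
    (k ℕ.* suc n) ∙ x              ≡⟨ ≡.cong (_∙ x) eq ⟨
    x + (a ℕ.* p) ∙ x              ≈⟨ +-congˡ (*p∙x≈0 a x) ⟩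
    x + 0#                         ≈⟨ +-identityʳ x ⟩
    x                              ∎
  -- In this case `1 + k * suc n` is a multiple of `p`, so `k` is an inverse up to sign; the factor
  -- `pred p` corrects the sign.
  ... | Bézout.+- a k eq = pred p ℕ.* k , λ x → begin
    (pred p ℕ.* k) ∙ (suc n ∙ x)        ≈⟨ ×-assocˡ (suc n ∙ x) (pred p) k ⟨
    pred p ∙ (k ∙ (suc n ∙ x))          ≈⟨ pred-p∙x≈-x _ ⟩
    - (k ∙ (suc n ∙ x))                 ≈⟨ +-inverseʳ-unique _ _ (trans (+-comm _ _) (begin
      x + k ∙ (suc n ∙ x)        ≈⟨ +-congˡ (×-assocˡ x k (suc n)) ⟩
      x + (k ℕ.* suc n) ∙ x      ≡⟨ ≡.cong (_∙ x) eq ⟩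
      (a ℕ.* p) ∙ x              ≈⟨ *p∙x≈0 a x ⟩
      0#                         ∎)) ⟨
    x                                   ∎

  private
    ∙-recover : ∀ {i j x u v} → i < j → j < p → i ∙ x + u ≈ j ∙ x + v → ∃ λ k → x ≈ k ∙ (u - v)
    ∙-recover {i} {j} {x} {u} {v} i<j j<p eq
      with n , i+1+n≡j ← ℕₚ.m≤n⇒∃[o]m+o≡n i<j
      with k , k-inverse ← ∙-inverse n (ℕₚ.≤-<-trans
             (≡.subst (suc n ≤_) (≡.trans (ℕₚ.+-suc i n) i+1+n≡j) (ℕₚ.m≤n+m (suc n) i)) j<p)
      = k , trans (sym (k-inverse x)) (×-congʳ k (x≈z//y _ v u (+-cancelˡ (i ∙ x) _ _ (begin
        i ∙ x + (suc n ∙ x + v)     ≈⟨ +-assoc _ _ _ ⟨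
        i ∙ x + suc n ∙ x + v       ≈⟨ +-congʳ (×-homo-+ x i (suc n)) ⟨
        (i ℕ.+ suc n) ∙ x + v       ≡⟨ ≡.cong (λ m → m ∙ x + v) (≡.trans (ℕₚ.+-suc i n) i+1+n≡j) ⟩
        j ∙ x + v                   ≈⟨ eq ⟨
        i ∙ x + u                   ∎))))

  -- If `i` and `j` differ, their difference is invertible modulo `p`, and the equation can be
  -- solved for `x`. This is the exchange argument behind `extend-independent`.
  ∙-cancel-or-recover : ∀ {i j x u v} → i < p → j < p → i ∙ x + u ≈ j ∙ x + v →
    i ≡ j ⊎ ∃ λ k → x ≈ k ∙ (u - v)
  ∙-cancel-or-recover {i} {j} {x} {u} {v} i<p j<p eq with ℕₚ.<-cmp i j
  ... | tri< i<j _ _ = inj₂ (∙-recover i<j j<p eq)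
  ... | tri≈ _ i≡j _ = inj₁ i≡j
  ... | tri> _ _ j<i with k , x≈ ← ∙-recover j<i i<p (sym eq) = inj₂ (k ℕ.* pred p , (begin
    x                        ≈⟨ x≈ ⟩
    k ∙ (v - u)              ≈⟨ ×-congʳ k (⁻¹-anti-homo‿- u v) ⟨
    k ∙ (- (u - v))          ≈⟨ ×-congʳ k (pred-p∙x≈-x (u - v)) ⟨
    k ∙ (pred p ∙ (u - v))   ≈⟨ ×-assocˡ (u - v) k (pred p) ⟩
    (k ℕ.* pred p) ∙ (u - v) ∎))

  ∙-cancel : ∀ {i j x} → i < p → j < p → ¬ (x ≈ 0#) → i ∙ x ≈ j ∙ x → i ≡ j
  ∙-cancel i<p j<p x≉0 eq with ∙-cancel-or-recover i<p j<p (+-congʳ {0#} eq)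
  ... | inj₁ i≡j        = i≡j
  ... | inj₂ (k , x≈k0) =
    contradiction (trans x≈k0 (trans (×-congʳ k (-‿inverseʳ 0#)) (∙-0# k))) x≉0

  -- Linear combinations over the prime field.

  ·≡∙ : ∀ n x → n · x ≡ n ∙ x
  ·≡∙ zero    x = ≡.refl
  ·≡∙ (suc n) x = ≡.cong (x +_) (·≡∙ n x)

  0ᶜ : ∀ {r} → Fin r → Fin p
  0ᶜ _ = 0 mod p

  -- One operation on coefficient tuples covers sums (`k` equal to 1), differences (`k` equal to
  -- `pred p`) and multiples (`c` equal to `0ᶜ`).
  axpy : ∀ {r} → ℕ → (c d : Fin r → Fin p) → Fin r → Fin p
  axpy k c d i = (toℕ (c i) ℕ.+ k ℕ.* toℕ (d i)) mod p

  toℕ-axpy : ∀ {r} k (c d : Fin r → Fin p) i →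
    toℕ (axpy k c d i) ≡ (toℕ (c i) ℕ.+ k ℕ.* toℕ (d i)) % p
  toℕ-axpy k c d i = toℕ-fromℕ< _

  axpy-injective : ∀ {r} k (c c′ d : Fin r → Fin p) → axpy k c d ≗ axpy k c′ d → c ≗ c′
  axpy-injective k c c′ d eq i = toℕ-injective (+-cancelʳ-% _ _ (k ℕ.* toℕ (d i)) p
    (toℕ<n (c i)) (toℕ<n (c′ i))
    (≡.trans (≡.sym (toℕ-axpy k c d i)) (≡.trans (≡.cong toℕ (eq i)) (toℕ-axpy k c′ d i))))

  module _ {m : ℕ} where

    comb-suc : ∀ {r} (c : Fin (suc r) → Fin p) (b : Fin (suc r) → Vect m) t →
      comb c b t ≈ toℕ (c zero) ∙ b zero t + comb (c ∘ suc) (b ∘ suc) t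
    comb-suc c b t = +-congʳ (reflexive (·≡∙ (toℕ (c zero)) (b zero t)))

    comb-cong : ∀ {r} {c d : Fin r → Fin p} (b : Fin r → Vect m) t → c ≗ d → comb c b t ≈ comb d b t
    comb-cong {zero}  b t c≗d = refl
    comb-cong {suc r} b t c≗d =
      +-cong (reflexive (≡.cong (λ i → toℕ i · b zero t) (c≗d zero))) (comb-cong (b ∘ suc) t (c≗d ∘ suc))

    comb-axpy : ∀ {r} k (c d : Fin r → Fin p) (b : Fin r → Vect m) t →
      comb (axpy k c d) b t ≈ comb c b t + k ∙ comb d b t
    comb-axpy {zero}  k c d b t = sym (trans (+-identityˡ _) (∙-0# k))
    comb-axpy {suc r} k c d b t = begin
      comb (axpy k c d) b t
        ≈⟨ comb-suc (axpy k c d) b t ⟩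
      toℕ (axpy k c d zero) ∙ x + comb (axpy k (c ∘ suc) (d ∘ suc)) (b ∘ suc) t
        ≈⟨ +-cong head (comb-axpy k (c ∘ suc) (d ∘ suc) (b ∘ suc) t) ⟩
      (c₀ ∙ x + k ∙ (d₀ ∙ x)) + (u + k ∙ v)
        ≈⟨ +-interchange _ _ _ _ ⟩
      (c₀ ∙ x + u) + (k ∙ (d₀ ∙ x) + k ∙ v)
        ≈⟨ +-congˡ (×-distrib-+ (d₀ ∙ x) v k) ⟨
      (c₀ ∙ x + u) + k ∙ (d₀ ∙ x + v)
        ≈⟨ +-cong (comb-suc c b t) (×-congʳ k (comb-suc d b t)) ⟨
      comb c b t + k ∙ comb d b t ∎
      where
      x = b zero t
      c₀ = toℕ (c zero)
      d₀ = toℕ (d zero)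
      u = comb (c ∘ suc) (b ∘ suc) t
      v = comb (d ∘ suc) (b ∘ suc) t
      head : toℕ (axpy k c d zero) ∙ x ≈ c₀ ∙ x + k ∙ (d₀ ∙ x)
      head = begin
        toℕ (axpy k c d zero) ∙ x           ≡⟨ ≡.cong (_∙ x) (toℕ-axpy k c d zero) ⟩
        ((c₀ ℕ.+ k ℕ.* d₀) % p) ∙ x         ≈⟨ %-∙ (c₀ ℕ.+ k ℕ.* d₀) x ⟩
        (c₀ ℕ.+ k ℕ.* d₀) ∙ x               ≈⟨ ×-homo-+ x c₀ (k ℕ.* d₀) ⟩
        c₀ ∙ x + (k ℕ.* d₀) ∙ x             ≈⟨ +-congˡ (×-assocˡ x k d₀) ⟨
        c₀ ∙ x + k ∙ (d₀ ∙ x)               ∎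

    comb-0ᶜ : ∀ {r} (b : Fin r → Vect m) t → comb 0ᶜ b t ≈ 0#
    comb-0ᶜ {zero}  b t = refl
    comb-0ᶜ {suc r} b t = trans (comb-suc 0ᶜ b t) (trans (+-cong
      (trans (reflexive (≡.cong (_∙ b zero t) (toℕ-fromℕ< (m%n<n 0 p)))) (%-∙ 0 (b zero t)))
      (comb-0ᶜ (b ∘ suc) t)) (+-identityˡ 0#))

  -- Spans and bases of the field over its prime field.

  -- Field elements are treated as vectors with one coordinate (Vect 0), so that comb applies.
  record Span {r} (e : Fin r → Vect 0) (x : K) : Set ℓ where
    constructor _,_
    field
      coefficients : Fin r → Fin p
      combination  : x ≈ comb coefficients e zero

  module _ {r} {e : Fin r → Vect 0} where

    span-cong : ∀ {x y} → x ≈ y → Span e x → Span e y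
    span-cong x≈y (c , eq) = c , trans (sym x≈y) eq

    span-0 : Span e 0#
    span-0 = 0ᶜ , sym (comb-0ᶜ e zero)

    span-axpy : ∀ k {x y} → Span e x → Span e y → Span e (x + k ∙ y)
    span-axpy k (c , x≈) (d , y≈) =
      axpy k c d , trans (+-cong x≈ (×-congʳ k y≈)) (sym (comb-axpy k c d e zero))

    span-∙ : ∀ k {x} → Span e x → Span e (k ∙ x)
    span-∙ k x∈ = span-cong (+-identityˡ _) (span-axpy k span-0 x∈)

    span-+ : ∀ {x y} → Span e x → Span e y → Span e (x + y)
    span-+ x∈ y∈ = span-cong (+-congˡ (+-identityʳ _)) (span-axpy 1 x∈ y∈)

    span-- : ∀ {x y} → Span e x → Span e y → Span e (x - y)
    span-- x∈ y∈ = span-cong (+-congˡ (pred-p∙x≈-x _)) (span-axpy (pred p) x∈ y∈)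

    spanCode : ∀ {x} → Span e x → Fin (p ^ r)
    spanCode (c , _) = funToFin c

    spanCode-injective : ∀ {x y} (x∈ : Span e x) (y∈ : Span e y) → spanCode x∈ ≡ spanCode y∈ → x ≈ y
    spanCode-injective (c , x≈) (d , y≈) eq =
      trans x≈ (trans (comb-cong e zero (funToFin-injective c d eq)) (sym y≈))

    span? : Decidable (Span e)
    span? x = map′
      (λ { (i , eq) → finToFun i , eq })
      (λ { (c , eq) → funToFin c , trans eq (comb-cong e zero (≡.sym ∘ finToFun-funToFin c)) })
      (any? λ i → x ≈? comb {p = p} (finToFun i) e zero)

    spanning⇒≤ : (∀ x → Span e x) → q ≤ p ^ r
    spanning⇒≤ all∈ = injective⇒≤ {f = λ i → spanCode (all∈ (enum i))} λ {i} {j} eq →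
      proj₁ (proj₂ order) _ _ (spanCode-injective (all∈ (enum i)) (all∈ (enum j)) eq)

  -- Phrased as injectivity of the coefficient map, the form in which counting applies directly.
  Independent : ∀ {r} → (Fin r → Vect 0) → Set ℓ
  Independent e = ∀ c d → comb {p = p} c e zero ≈ comb d e zero → c ≗ d

  independent⇒≤ : ∀ {r} (e : Fin r → Vect 0) → Independent e → p ^ r ≤ q
  independent⇒≤ {r} e independent =
    injective⇒≤ {f = λ i → code (comb (finToFun i) e zero)} λ {i} {j} eq →
      finToFun-injective {p} {r} i j (independent _ _ (code-injective eq))

  -- Two equal combinations either agree in the coefficient of `x`, which then cancels, or exhibit
  -- `x` as a multiple of a difference of elements of the span of `e`.
  extend-independent : ∀ {r} (e : Fin r → Vect 0) → Independent e →
    ∀ x → ¬ Span e x → Independent ((λ _ → x) ∷ e)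
  extend-independent e independent x x∉ c d eq
    with ∙-cancel-or-recover (toℕ<n (c zero)) (toℕ<n (d zero))
           (trans (sym (comb-suc c e′ zero)) (trans eq (comb-suc d e′ zero)))
    where e′ = (λ _ → x) ∷ e
  ... | inj₂ (k , x≈) =
    contradiction (span-cong (sym x≈) (span-∙ k (span-- (c ∘ suc , refl) (d ∘ suc , refl)))) x∉
  ... | inj₁ c₀≡d₀ = λ
    { zero    → toℕ-injective c₀≡d₀
    ; (suc i) → independent (c ∘ suc) (d ∘ suc)
        (+-cancelˡ (toℕ (d zero) · x) _ _
          (trans (+-congʳ (reflexive (≡.cong (_· x) (≡.sym c₀≡d₀)))) eq)) i
    }

  grow : ∀ {r} (e : Fin r → Vect 0) → Independent e →
    (∀ x → Span e x) ⊎ ∃ λ (e′ : Fin (suc r) → Vect 0) → Independent e′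
  grow e independent with all? (λ i → span? {e = e} (enum i))
  ... | yes all∈ = inj₁ λ x → span-cong (enum-code x) (all∈ (code x))
  ... | no ¬all∈ with i , x∉ ← ¬∀⟶∃¬ q _ (λ i → span? {e = e} (enum i)) ¬all∈ =
    inj₂ ((λ _ → enum i) ∷ e , extend-independent e independent (enum i) x∉)

  -- Dimension is replaced by counting: fewer than `h` elements span fewer than `q` values, so some
  -- field element lies outside and can be adjoined.
  independentFamily : ∀ r → r ≤ h → ∃ λ (e : Fin r → Vect 0) → Independent e
  independentFamily zero    _   = (λ ()) , λ _ _ _ ()
  independentFamily (suc r) r<h with e , independent ← independentFamily r (ℕₚ.<⇒≤ r<h)
    with grow e independent
  ... | inj₁ all∈ = contradiction (spanning⇒≤ all∈) (ℕₚ.<⇒≱ (ℕₚ.^-monoʳ-< p 1<p r<h))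
  ... | inj₂ next = next

  -- If `h` independent elements could be extended once more, there would be `p ^ suc h` distinct
  -- combinations, more than `q`.
  spanningFamily : ∃ λ (e : Fin h → Vect 0) → ∀ x → Span e x
  spanningFamily with e , independent ← independentFamily h ℕₚ.≤-refl with grow e independent
  ... | inj₁ all∈ = e , all∈
  ... | inj₂ (e′ , independent′) =
    contradiction (independent⇒≤ e′ independent′) (ℕₚ.<⇒≱ (ℕₚ.^-monoʳ-< p 1<p (ℕₚ.n<1+n h)))

  h≡suc : ∃ λ k → h ≡ suc k
  h≡suc = exponent≡suc h (code 1#) (code 0#) (1≉0 ∘ code-injective)
    where
    -- `h` is a fixed module parameter, so the case split is made on a fresh exponent `n`. Exponent
    -- zero would leave a single code for both `1#` and `0#`.
    exponent≡suc : ∀ n (i j : Fin (p ^ n)) → i ≢ j → ∃ λ k → n ≡ suc k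
    exponent≡suc zero    zero zero i≢j = contradiction ≡.refl i≢j
    exponent≡suc (suc k) _    _    _   = k , ≡.refl

  nonemptySpanningFamily : ∃ λ k → h ≡ suc k × ∃ λ (e : Fin (suc k) → Vect 0) → ∀ x → Span e x
  nonemptySpanningFamily with k , h≡ ← h≡suc =
    k , h≡ , ≡.subst (λ n → ∃ λ (e : Fin n → Vect 0) → ∀ x → Span e x) h≡ spanningFamily

  -- When `e` has `h` elements, `e ∘ suc` spans the hyperplane `S` of the overview, and `coordinate`
  -- labels classes modulo `S`: equal labels cancel the leading terms and leave a difference in `S`.
  module FirstCoordinate {k} (e : Fin (suc k) → Vect 0) (spans : ∀ x → Span e x) where

    coordinate : K → Fin p
    coordinate x = Span.coefficients (spans x) zero

    coordinate-≡⇒-∈ : ∀ x y → coordinate x ≡ coordinate y → Span (e ∘ suc) (x - y)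
    coordinate-≡⇒-∈ x y eq with spans x | spans y
    ... | c , x≈ | d , y≈ =
      span-cong (x≈z//y _ y x (begin
        (u - v) + y            ≈⟨ +-congˡ (trans y≈ (comb-suc d e zero)) ⟩
        (u - v) + (d₀x + v)    ≈⟨ +-congˡ (+-comm d₀x v) ⟩
        (u - v) + (v + d₀x)    ≈⟨ +-assoc (u - v) v d₀x ⟨
        (u - v) + v + d₀x      ≈⟨ +-congʳ (trans (+-assoc u (- v) v) (trans (+-congˡ (-‿inverseˡ v)) (+-identityʳ u))) ⟩
        u + d₀x                ≈⟨ +-comm u d₀x ⟩
        d₀x + u                ≡⟨ ≡.cong (λ i → toℕ i ∙ e zero zero + u) eq ⟨
        toℕ (c zero) ∙ e zero zero + u ≈⟨ comb-suc c e zero ⟨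
        comb c e zero          ≈⟨ x≈ ⟨
        x                      ∎))
        (span-- (c ∘ suc , refl) (d ∘ suc , refl))
      where
      u = comb (c ∘ suc) (e ∘ suc) zero
      v = comb (d ∘ suc) (e ∘ suc) zero
      d₀x = toℕ (d zero) ∙ e zero zero

  -- Covectors and hyperplanes.

  module _ {m : ℕ} where

    dot : Vect m → Vect m → K
    dot a v = sum (λ t → a t * v t)

    dot-cong : ∀ a {v w} → v ≈V w → dot a v ≈ dot a w
    dot-cong a v≈w = sum-cong _ _ (λ t → *-congˡ {a t} (v≈w t))

    dot-+ : ∀ a v w → dot a (v +V w) ≈ dot a v + dot a w
    dot-+ a v w = trans (sum-cong _ _ (λ t → distribˡ (a t) (v t) (w t)))
      (∑-distrib-+ (λ t → a t * v t) (λ t → a t * w t))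

    dot-* : ∀ a s v → dot a (λ t → s * v t) ≈ s * dot a v
    dot-* a s v = trans
      (sum-cong (λ t → a t * (s * v t)) (λ t → s * (a t * v t)) (λ t →
        trans (sym (*-assoc (a t) s (v t))) (trans (*-congʳ (*-comm (a t) s)) (*-assoc s (a t) (v t)))))
      (sym (*-distribˡ-sum s (λ t → a t * v t)))

    dot-∙ : ∀ a n v → dot a (λ t → n ∙ v t) ≈ n ∙ dot a v
    dot-∙ a n v = trans (dot-cong a (λ t → ∙≈* n (v t)))
      (trans (dot-* a (n ∙ 1#) v) (sym (∙≈* n (dot a v))))

    dot-0V : ∀ a → dot a 0V ≈ 0#
    dot-0V a = dot-∙ a 0 0V

    dot-- : ∀ a a′ v → dot (λ t → a t - a′ t) v ≈ dot a v - dot a′ v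
    dot-- a a′ v = x≈z//y _ _ _ (trans
      (sym (∑-distrib-+ (λ t → (a t - a′ t) * v t) (λ t → a′ t * v t)))
      (sum-cong _ _ (λ t → trans (sym (distribʳ (v t) (a t - a′ t) (a′ t)))
        (*-congʳ (trans (+-assoc _ _ _) (trans (+-congˡ (-‿inverseˡ (a′ t))) (+-identityʳ (a t))))))))

    dot-comb∈ : ∀ a {r k} (b : Fin r → Vect m) {e : Fin k → Vect 0} →
      (∀ j → Span e (dot a (b j))) → ∀ (c : Fin r → Fin p) → Span e (dot a (comb c b))
    dot-comb∈ a {zero}  b ∈e c = span-cong (sym (dot-0V a)) span-0
    dot-comb∈ a {suc r} b ∈e c = span-cong
      (sym (trans (dot-cong a (comb-suc c b))
        (trans (dot-+ a (λ t → toℕ (c zero) ∙ b zero t) (comb (c ∘ suc) (b ∘ suc)))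
          (+-congʳ (dot-∙ a (toℕ (c zero)) (b zero))))))
      (span-+ (span-∙ (toℕ (c zero)) (∈e zero)) (dot-comb∈ a (b ∘ suc) (∈e ∘ suc) (c ∘ suc)))

    private
      vec : Fin (q ^ suc m) → Vect m
      vec i t = enum (finToFun i t)

    -- There are more covectors a than tuples of first coordinates of the values dot a (b j),
    -- and the difference of two covectors with the same tuple maps all of b into the span.
    small-functional : ∀ {k} (e : Fin (suc k) → Vect 0) → (∀ x → Span e x) →
      (b : Fin (h ℕ.* m) → Vect m) →
      ∃ λ a → (∃ λ t → ¬ (a t ≈ 0#)) × (∀ j → Span (e ∘ suc) (dot a (b j)))
    small-functional e spans b
      with pigeonhole fewer (λ i → funToFin (λ j → coordinate (dot (vec i) (b j))))
      where
      open FirstCoordinate e spans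
      -- The rank `h * m` enters here: there are `q ^ m` tuples of labels, a factor `q` fewer than
      -- covectors.
      fewer : p ^ (h ℕ.* m) < q ^ suc m
      fewer = ≡.subst (_< q ^ suc m) (ℕₚ.^-*-assoc p h m)
        (ℕₚ.^-monoʳ-< q (1<q h≡suc) (ℕₚ.n<1+n m))
        where
        1<q : (∃ λ k → h ≡ suc k) → 1 < q
        1<q (k , h≡) = ≡.subst (λ n → 1 < p ^ n) (≡.sym h≡) (ℕₚ.^-monoʳ-< p 1<p {0} {suc k} ℕ.z<s)
    ... | i , j , i<j , same = (λ t → vec i t - vec j t) , nonzero , λ l →
      span-cong (sym (dot-- (vec i) (vec j) (b l)))
        (coordinate-≡⇒-∈ _ _ (funToFin-injective _ _ same l))
      where
      open FirstCoordinate e spans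
      nonzero : ∃ λ t → ¬ (vec i t - vec j t ≈ 0#)
      nonzero = ¬∀⟶∃¬ (suc m) _ (λ t → (vec i t - vec j t) ≈? 0#) λ all≈0 →
        <⇒≢ i<j (finToFun-injective {q} {suc m} i j
          (λ t → proj₁ (proj₂ order) _ _ (x-y≈0⇒x≈y (all≈0 t))))

    scale-cancel⇒samePoint : ∀ {s s′} {u v : Vect m} → ¬ (s′ ≈ 0#) →
      (∀ t → s * u t ≈ s′ * v t) → SamePoint u v
    scale-cancel⇒samePoint {s} {s′} {u} {v} s′≉0 eq with s⁻¹ , s′s⁻¹≈1 ← proj₂ isField s′ s′≉0 =
      s⁻¹ * s , λ t → *-cancelˡ-nonzero s′≉0 (begin
        s′ * v t                ≈⟨ eq t ⟨
        s * u t                 ≈⟨ *-congʳ (*-identityˡ s) ⟨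
        1# * s * u t            ≈⟨ *-congʳ (*-congʳ s′s⁻¹≈1) ⟨
        s′ * s⁻¹ * s * u t      ≈⟨ *-congʳ (*-assoc s′ s⁻¹ s) ⟩
        s′ * (s⁻¹ * s) * u t    ≈⟨ *-assoc s′ (s⁻¹ * s) (u t) ⟩
        s′ * (s⁻¹ * s * u t)    ∎)

    Distinct : ∀ {k} → (Fin k → Vect m) → Set _
    Distinct x = ∀ i j → i ≢ j → ¬ SamePoint (x i) (x j)

    distinct⇒≡ : ∀ {k} {x : Fin k → Vect m} → Distinct x → ∀ {i j} → SamePoint (x i) (x j) → i ≡ j
    distinct⇒≡ distinct {i} {j} same with i ≟ᶠ j
    ... | yes i≡j = i≡j
    ... | no  i≢j = contradiction same (distinct i j i≢j)

    -- Counting vectors and points off and on the hyperplane.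

    module _ {r} (a : Vect m) (b : Fin r → Vect m) where

      InKernel : Fin (p ^ r) → Set ℓ
      InKernel i = dot a (comb {p = p} (finToFun i) b) ≈ 0#

      inKernel? : Decidable InKernel
      inKernel? i = dot a (comb {p = p} (finToFun i) b) ≈? 0#

      comb-funToFin : (c : Fin r → Fin p) → comb (finToFun (funToFin c)) b ≈V comb c b
      comb-funToFin c t = comb-cong b t (finToFun-funToFin c)

      -- A counting form of rank-nullity. The values of `dot a` have at most `p ^ k` codes, and
      -- subtracting a fixed member of a fibre sends that fibre injectively into the kernel.
      kernel-size : ∀ {k} {e : Fin k → Vect 0} → (∀ j → Span e (dot a (b j))) →
        (E : Enumeration InKernel) → p ^ r ≤ p ^ k ℕ.* size E
      kernel-size {k} ∈e E = fibres-bound value shift shift-injective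
        where
        coeffs : Fin (p ^ r) → Fin r → Fin p
        coeffs = finToFun
        value∈ : ∀ i → _
        value∈ i = dot-comb∈ a b ∈e (coeffs i)
        value : Fin (p ^ r) → Fin (p ^ k)
        value i = spanCode (value∈ i)
        difference : Fin (p ^ r) → Fin (p ^ r) → Fin (p ^ r)
        difference i j = funToFin (axpy (pred p) (coeffs i) (coeffs j))
        difference-inKernel : ∀ i j → value i ≡ value j → InKernel (difference i j)
        difference-inKernel i j eq = begin
          dot a (comb (finToFun (difference i j)) b)
            ≈⟨ dot-cong a (λ t → trans (comb-funToFin (axpy (pred p) (coeffs i) (coeffs j)) t)
                 (comb-axpy (pred p) (coeffs i) (coeffs j) b t)) ⟩
          dot a (u +V (λ t → pred p ∙ v t))
            ≈⟨ trans (dot-+ a u (λ t → pred p ∙ v t)) (+-congˡ (dot-∙ a (pred p) v)) ⟩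
          dot a u + pred p ∙ dot a v
            ≈⟨ +-cong (spanCode-injective (value∈ i) (value∈ j) eq) (pred-p∙x≈-x (dot a v)) ⟩
          dot a v - dot a v
            ≈⟨ -‿inverseʳ (dot a v) ⟩
          0# ∎
          where
          u = comb (coeffs i) b
          v = comb (coeffs j) b
        shift : ∀ i j → value i ≡ value j → Fin (size E)
        shift i j eq = index E (difference-inKernel i j eq)
        shift-injective : ∀ {i i′} j eq eq′ → shift i j eq ≡ shift i′ j eq′ → i ≡ i′
        shift-injective {i} {i′} j eq eq′ same = finToFun-injective {p} {r} i i′
          (axpy-injective (pred p) (coeffs i) (coeffs i′) (coeffs j)
            (funToFin-injective _ _ (index-injective E _ _ same)))

      -- The `p - 1` nonzero prime field multiples of each `x i` stay in the span of `b` and off the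
      -- kernel, and all these multiples are different.
      points-off-hyperplane : ∀ {k} (x : Fin k → Vect m) → (∀ i → InSpanFp p b (x i)) →
        (∀ i → ¬ (dot a (x i) ≈ 0#)) → Distinct x →
        (F : Enumeration (¬_ ∘ InKernel)) → k ℕ.* pred p ≤ size F
      points-off-hyperplane x x∈ x-off distinct F = injective₂⇒≤ multiple multiple-injective
        where
        1+n<p : (n : Fin (pred p)) → suc (toℕ n) < p
        1+n<p n = ≡.subst (suc (toℕ n) <_) (ℕₚ.suc-pred p) (s≤s (toℕ<n n))
        -- The shift by `suc` makes the multipliers run from 1 to `p - 1`.
        scalar : Fin (pred p) → K
        scalar n = suc (toℕ n) ∙ 1#
        scalar≉0 : ∀ n → ¬ (scalar n ≈ 0#)
        scalar≉0 n eq = case ∙-cancel {j = 0} (1+n<p n) (ℕₚ.≤-<-trans z≤n 1<p) 1≉0 eq of λ ()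
        multipleCode : ∀ i → Fin (pred p) → Fin (p ^ r)
        multipleCode i n = funToFin (axpy (suc (toℕ n)) 0ᶜ (proj₁ (x∈ i)))
        comb-multipleCode : ∀ i n t → comb (finToFun (multipleCode i n)) b t ≈ scalar n * x i t
        comb-multipleCode i n t = begin
          comb (finToFun (multipleCode i n)) b t         ≈⟨ comb-funToFin (axpy (suc (toℕ n)) 0ᶜ c) t ⟩
          comb (axpy (suc (toℕ n)) 0ᶜ c) b t             ≈⟨ comb-axpy (suc (toℕ n)) 0ᶜ c b t ⟩
          comb 0ᶜ b t + suc (toℕ n) ∙ comb c b t         ≈⟨ trans (+-congʳ (comb-0ᶜ b t)) (+-identityˡ _) ⟩
          suc (toℕ n) ∙ comb c b t                       ≈⟨ ×-congʳ (suc (toℕ n)) (proj₂ (x∈ i) t) ⟨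
          suc (toℕ n) ∙ x i t                            ≈⟨ ∙≈* (suc (toℕ n)) (x i t) ⟩
          scalar n * x i t                               ∎
          where c = proj₁ (x∈ i)
        multiple-off : ∀ i n → ¬ InKernel (multipleCode i n)
        multiple-off i n eq = x-off i (x*y≈0⇒y≈0 (scalar≉0 n)
          (trans (sym (dot-* a (scalar n) (x i)))
            (trans (sym (dot-cong a (comb-multipleCode i n))) eq)))
        multiple : ∀ i → Fin (pred p) → Fin (size F)
        multiple i n = index F (multiple-off i n)
        multiple-injective : Injective₂ multiple
        -- Once the points agree, applying `dot a` reduces the comparison of multipliers to
        -- multiples of the nonzero element `dot a (x j)`.
        multiple-injective i n j l same = i≡j , toℕ-injective (ℕₚ.suc-injective
          (∙-cancel (1+n<p n) (1+n<p l) (x-off j) (begin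
            suc (toℕ n) ∙ dot a (x j)  ≈⟨ ∙≈* (suc (toℕ n)) _ ⟩
            scalar n * dot a (x j)     ≈⟨ dot-* a (scalar n) (x j) ⟨
            dot a (λ t → scalar n * x j t)
              ≈⟨ dot-cong a (λ t → trans (*-congˡ (reflexive (≡.cong (λ i → x i t) (≡.sym i≡j)))) (scaled t)) ⟩
            dot a (λ t → scalar l * x j t) ≈⟨ dot-* a (scalar l) (x j) ⟩
            scalar l * dot a (x j)     ≈⟨ ∙≈* (suc (toℕ l)) _ ⟨
            suc (toℕ l) ∙ dot a (x j)  ∎)))
          where
          scaled : ∀ t → scalar n * x i t ≈ scalar l * x j t
          scaled t = trans (sym (comb-multipleCode i n t)) (trans
            (reflexive (≡.cong (λ c → comb (finToFun c) b t) (index-injective F _ _ same)))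
            (comb-multipleCode j l t))
          i≡j : i ≡ j
          i≡j = distinct⇒≡ {x = x} distinct (scale-cancel⇒samePoint {u = x i} {x j} (scalar≉0 l) scaled)

    -- As `a t₀` is nonzero, the equation of the hyperplane determines coordinate `t₀` from the
    -- others. Dropping that coordinate therefore embeds the hyperplane in a space of `q ^ m`
    -- vectors.
    hyperplane-ext : ∀ a t₀ → ¬ (a t₀ ≈ 0#) → ∀ {v w} → dot a v ≈ 0# → dot a w ≈ 0# →
      (∀ j → v (punchIn t₀ j) ≈ w (punchIn t₀ j)) → v ≈V w
    hyperplane-ext a t₀ a≉0 {v} {w} v∈ w∈ eq t with t₀ ≟ᶠ t
    ... | no  t₀≢t = ≡.subst (λ s → v s ≈ w s) (punchIn-punchOut t₀≢t) (eq (punchOut t₀≢t))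
    ... | yes ≡.refl = *-cancelˡ-nonzero a≉0 (+-cancelʳ _ _ _ (begin
      a t₀ * v t₀ + sum (λ j → a (punchIn t₀ j) * v (punchIn t₀ j))  ≈⟨ sum-remove {i = t₀} (λ t → a t * v t) ⟨
      dot a v                                                        ≈⟨ trans v∈ (sym w∈) ⟩
      dot a w                                                        ≈⟨ sum-remove {i = t₀} (λ t → a t * w t) ⟩
      a t₀ * w t₀ + sum (λ j → a (punchIn t₀ j) * w (punchIn t₀ j))
        ≈⟨ +-congˡ (sum-cong _ _ (λ j → *-congˡ {a (punchIn t₀ j)} (eq j))) ⟨
      a t₀ * w t₀ + sum (λ j → a (punchIn t₀ j) * v (punchIn t₀ j))  ∎))

    -- All `q - 1` nonzero field multiples of each `x i` lie on the hyperplane and are different.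
    -- They miss the zero vector, which makes the inequality strict.
    points-on-hyperplane : ∀ a t₀ → ¬ (a t₀ ≈ 0#) →
      ∀ {k} (x : Fin k → Vect m) → (∀ i → dot a (x i) ≈ 0#) →
      (∀ i → NonzeroV (x i)) → Distinct x → k ℕ.* pred q < q ^ m
    points-on-hyperplane a t₀ a≉0 x x-on x-nonzero distinct
      with others , others≢ , others-injective ← complement (code 0#) =
      injective₂⇒< multiple multiple-injective (funToFin {m} (λ _ → code 0#)) multiple≢0
      where
      scalar : Fin (pred q) → K
      scalar = enum ∘ others
      scalar≉0 : ∀ s → ¬ (scalar s ≈ 0#)
      scalar≉0 s eq = others≢ s (≡.trans (≡.sym (code-enum (others s))) (code-cong eq))
      on : ∀ i s → dot a (λ t → scalar s * x i t) ≈ 0#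
      on i s = trans (dot-* a (scalar s) (x i)) (trans (*-congˡ (x-on i)) (zeroʳ (scalar s)))
      multiple : ∀ i → Fin (pred q) → Fin (q ^ m)
      multiple i s = funToFin {m} (λ j → code (scalar s * x i (punchIn t₀ j)))
      multiple≢0 : ∀ i s → multiple i s ≢ funToFin {m} (λ _ → code 0#)
      multiple≢0 i s eq = x-nonzero i (λ t → x*y≈0⇒y≈0 (scalar≉0 s)
        (hyperplane-ext a t₀ a≉0 (on i s) (dot-0V a) (λ j → code-injective (funToFin-injective _ _ eq j)) t))
      multiple-injective : Injective₂ multiple
      multiple-injective i s j l same = i≡j , others-injective s l
        -- `NonzeroV` is a bare negation; a nonzero coordinate is found by searching the finitely
        -- many coordinates.
        (proj₁ (proj₂ order) _ _ (scalars≈ (¬∀⟶∃¬ (suc m) _ (λ t → x j t ≈? 0#) (x-nonzero j))))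
        where
        scaled : ∀ t → scalar s * x i t ≈ scalar l * x j t
        scaled = hyperplane-ext a t₀ a≉0 (on i s) (on j l)
          (λ j → code-injective (funToFin-injective _ _ same j))
        i≡j : i ≡ j
        i≡j = distinct⇒≡ {x = x} distinct (scale-cancel⇒samePoint {u = x i} {x j} (scalar≉0 l) scaled)
        scalars≈ : (∃ λ t → ¬ (x j t ≈ 0#)) → scalar s ≈ scalar l
        scalars≈ (t , xt≉0) = *-cancelˡ-nonzero xt≉0 (begin
          x j t * scalar s   ≈⟨ *-comm _ _ ⟩
          scalar s * x j t   ≡⟨ ≡.cong (λ i → scalar s * x i t) i≡j ⟨
          scalar s * x i t   ≈⟨ scaled t ⟩
          scalar l * x j t   ≈⟨ *-comm _ _ ⟩
          x j t * scalar l   ∎)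

-- Assembling the counts for rank `h * suc m`.

module _ {ℓ₀ ℓ} (R : CommutativeRing ℓ₀ ℓ) (isField : FF.IsFieldCR R)
  (p h : ℕ) (p-prime : Prime p) (order : FF.HasOrder R (p ^ h)) where

  open FF R
  open CommutativeRing R using (0#)
  open FieldOfOrder R isField p h p-prime order
  open ℕₚ.≤-Reasoning

  private
    q : ℕ
    q = p ^ h

    instance
      p≢0 : NonZero p
      p≢0 = prime⇒nonZero p-prime

  -- Here `m` is one less than the projective dimension. Dividing the kernel bound by `p ^ h′`,
  -- which is `q / p`, leaves at least `p * q ^ m` tuples inside the kernel; the points off the
  -- hyperplane use the rest.
  off-count : ∀ m h′ k₁ inside outside → h ≡ suc h′ →
    p ^ (h ℕ.* suc m) ≤ p ^ h′ ℕ.* inside → k₁ ℕ.* pred p ≤ outside →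
    inside ℕ.+ outside ≡ p ^ (h ℕ.* suc m) →
    p ℕ.* q ^ m ℕ.+ k₁ ℕ.* pred p ≤ q ℕ.* q ^ m
  off-count m h′ k₁ inside outside h≡ kernel off-bound inside+outside = begin
    p ℕ.* q ^ m ℕ.+ k₁ ℕ.* pred p  ≤⟨ ℕₚ.+-mono-≤ p*q^m≤ off-bound ⟩
    inside ℕ.+ outside             ≡⟨ inside+outside ⟩
    p ^ (h ℕ.* suc m)              ≡⟨ ℕₚ.^-*-assoc p h (suc m) ⟨
    q ℕ.* q ^ m                    ∎
    where
    p*q^m≤ : p ℕ.* q ^ m ≤ inside
    p*q^m≤ = ℕₚ.*-cancelˡ-≤ (p ^ h′) {{ℕₚ.m^n≢0 p h′}} (begin
      p ^ h′ ℕ.* (p ℕ.* q ^ m)   ≡⟨ ℕₚ.*-assoc (p ^ h′) p (q ^ m) ⟨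
      p ^ h′ ℕ.* p ℕ.* q ^ m     ≡⟨ ≡.cong (ℕ._* q ^ m) (ℕₚ.*-comm (p ^ h′) p) ⟩
      p ^ suc h′ ℕ.* q ^ m       ≡⟨ ≡.cong (λ n → p ^ n ℕ.* q ^ m) h≡ ⟨
      q ℕ.* q ^ m                ≡⟨ ℕₚ.^-*-assoc p h (suc m) ⟩
      p ^ (h ℕ.* suc m)          ≤⟨ kernel ⟩
      p ^ h′ ℕ.* inside          ∎)

  point-counts : ∀ m (b : Fin (h ℕ.* suc m) → Vect (suc m)) k (pts : Fin k → Vect (suc m)) →
    (∀ i → InSpanFp p b (pts i)) → (∀ i → NonzeroV (pts i)) → Distinct pts →
    ∃ λ k₀ → ∃ λ k₁ → k₀ ℕ.+ k₁ ≡ k × k₀ ℕ.* pred q < q ℕ.* q ^ m ×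
      p ℕ.* q ^ m ℕ.+ k₁ ℕ.* pred p ≤ q ℕ.* q ^ m
  point-counts m b k pts pts∈ pts≉0 distinct =
    let h′ , h≡ , e , spans               = nonemptySpanningFamily
        a , (t₀ , a≉0) , ∈e               = small-functional e spans b
        on , off , on+off                 = partition (λ i → dot a (pts i) ≈? 0#)
        inside , outside , inside+outside = partition (inKernel? a b)
    in
    size on , size off , on+off ,
    points-on-hyperplane a t₀ a≉0 (pts ∘ elem on) (holds on) (pts≉0 ∘ elem on) (sub on) ,
    off-count m h′ (size off) (size inside) (size outside) h≡
      (kernel-size a b ∈e inside)
      (points-off-hyperplane a b (pts ∘ elem off) (pts∈ ∘ elem off) (holds off) (sub off) outside)
      inside+outside
    where
    sub : ∀ {ℓ} {P : Fin k → Set ℓ} (E : Enumeration P) → Distinct (pts ∘ elem E)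
    sub E i j i≢j = distinct _ _ (i≢j ∘ elem-injective E i j)

-- Combining the two counts into the bound.

open import Data.Nat using (_+_; _*_; _∸_)

-- The first inequality is multiplied by `p - 1`, the second by `q - 1`, and the results are added.
combine-counts : ∀ p q Q k₀ k₁ .{{_ : NonZero p}} .{{_ : NonZero q}} →
  k₀ * (q ∸ 1) < q * Q → p * Q + k₁ * (p ∸ 1) ≤ q * Q →
  (k₀ + k₁) * (p ∸ 1) * (q ∸ 1) ≤ Q * (q ∸ 1) * (q ∸ 1) + (Q ∸ 1) * (p ∸ 1)
-- With `Q` zero the strict inequality has right side zero. Afterwards `P`, `T` and `Q` denote
-- predecessors, so no truncated subtraction remains.
combine-counts (suc P) (suc T) zero    k₀ k₁ on off =
  contradiction (≡.subst (k₀ * T <_) (ℕₚ.*-zeroʳ (suc T)) on) λ ()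
combine-counts (suc P) (suc T) (suc Q) k₀ k₁ on off =
  -- The added terms replace subtractions: `P * suc Q * T` comes from the vectors inside the kernel,
  -- `P` from the missed zero vector.
  ℕₚ.+-cancelʳ-≤ (P * suc Q * T + P) _ _ (begin
    (k₀ + k₁) * P * T + (P * suc Q * T + P)          ≡⟨ lhs k₀ k₁ P T Q ⟩
    suc (k₀ * T) * P + (P * suc Q + k₁ * P) * T      ≤⟨ ℕₚ.+-mono-≤ (ℕₚ.*-monoˡ-≤ P on)
                                                          (ℕₚ.*-monoˡ-≤ T off′) ⟩
    suc T * suc Q * P + T * suc Q * T                ≡⟨ rhs P T Q ⟩
    suc Q * T * T + Q * P + (P * suc Q * T + P)      ∎)
  where
  open ℕₚ.≤-Reasoning
  off′ : P * suc Q + k₁ * P ≤ T * suc Q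
  off′ = ℕₚ.+-cancelˡ-≤ (suc Q) _ _
    (≡.subst (_≤ suc T * suc Q) (ℕₚ.+-assoc (suc Q) (P * suc Q) (k₁ * P)) off)
  lhs : ∀ k₀ k₁ P T Q → (k₀ + k₁) * P * T + (P * suc Q * T + P) ≡
    suc (k₀ * T) * P + (P * suc Q + k₁ * P) * T
  lhs = solve-∀
  rhs : ∀ P T Q → suc T * suc Q * P + T * suc Q * T ≡
    suc Q * T * T + Q * P + (P * suc Q * T + P)
  rhs = solve-∀

-- The size of the linear set is bounded through the length of every list of representatives of
-- distinct points, and the denominators `p - 1` and `q - 1` are cleared.
theorem3p4 : ∀ {c ℓ} (R : CommutativeRing c ℓ) → FF.IsFieldCR R →
    (p h m : ℕ) → Prime p → FF.HasOrder R (p ^ h) → 1 ≤ m →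
    (b : Fin (h * m) → FF.Vect R m) → FF.LinIndepFp R p b →
    (k : ℕ) (pts : Fin k → FF.Vect R m) →
    (∀ i → FF.InSpanFp R p b (pts i)) →
    (∀ i → FF.NonzeroV R (pts i)) →
    (∀ i j → i ≢ j → ¬ FF.SamePoint R (pts i) (pts j)) →
    k * (p ∸ 1) * (p ^ h ∸ 1)
      ≤ (p ^ h) ^ (m ∸ 1) * (p ^ h ∸ 1) * (p ^ h ∸ 1) + ((p ^ h) ^ (m ∸ 1) ∸ 1) * (p ∸ 1)
theorem3p4 R isField p h (suc m) p-prime order _ b _ k pts pts∈ pts≉0 distinct =
  let k₀ , k₁ , k₀+k₁≡k , on , off =
        point-counts R isField p h p-prime order m b k pts pts∈ pts≉0 distinct
  in
  ≡.subst (λ n → n * (p ∸ 1) * (p ^ h ∸ 1) ≤ _) k₀+k₁≡k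
    (combine-counts p (p ^ h) ((p ^ h) ^ m) k₀ k₁ {{p≢0}} {{ℕₚ.m^n≢0 p h {{p≢0}}}} on off)
  where
  p≢0 : NonZero p
  p≢0 = prime⇒nonZero p-prime
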